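{- For every nonnegative integer $n$, $$\sum_{k=0}^{\infty}(-1)^k(4k+1)\,\frac{(-4n)_k\,(-3n+\tfrac18)_k\,(\tfrac12)_k}{k!\,(3n+\tfrac{11}{8})_k\,(4n+\tfrac32)_k}=\left(\frac{2^8 3^3}{7^7}\right)^n\frac{(\tfrac{11}{24})_n(\tfrac38)_n(\tfrac78)_n(\tfrac{19}{24})_n(\tfrac98)_n^2}{(\tfrac{11}{56})_n(\tfrac{43}{56})_n(\tfrac{19}{56})_n(\tfrac{51}{56})_n(\tfrac{27}{56})_n(\tfrac{59}{56})_n}.$$ (The sum is finite, since $(-4n)_k=0$ for $k>4n$.)
   Context: $(a)_j=\Gamma(a+j)/\Gamma(a)=a(a+1)\cdots(a+j-1)$ denotes the rising factorial (Pochhammer symbol), with $(a)_0=1$. -}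

module Defs where

open import Data.Integer.Base using (+_)
open import Data.Nat.Base as ℕ using (ℕ; zero; suc; _!)
open import Data.Nat.Properties using (_!≢0)
open import Data.Rational.Base
open import Data.Rational.Properties

open import Algebra.Bundles using (module CommutativeRing)
open import Algebra.Properties.Semiring.Exp (CommutativeRing.semiring +-*-commutativeRing) public
  using (_^_)
open import Algebra.Properties.CommutativeMonoid.Sum +-0-commutativeMonoid public
  using (sum; sum-syntax)

fromℕ : ℕ → ℚ
fromℕ m = + m / 1

infix 9 _₍_₎

-- The rising factorial a (a + 1) ⋯ (a + j - 1).
_₍_₎ : ℚ → ℕ → ℚ
a ₍ zero  ₎ = 1ℚ
a ₍ suc j ₎ = a ₍ j ₎ * (a + fromℕ j)

0<* : ∀ {p q} → 0ℚ < p → 0ℚ < q → 0ℚ < p * q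
0<* {p} {q} 0<p 0<q =
  positive⁻¹ (p * q) {{pos*pos⇒pos p {{positive 0<p}} q {{positive 0<q}}}}

0≤fromℕ : ∀ m → 0ℚ ≤ fromℕ m
0≤fromℕ m = nonNegative⁻¹ (fromℕ m) {{normalize-nonNeg m 1}}

0</ : ∀ m d .{{_ : ℕ.NonZero m}} .{{_ : ℕ.NonZero d}} → 0ℚ < + m / d
0</ m d = positive⁻¹ (+ m / d) {{normalize-pos m d}}

0<rising : ∀ {a} → 0ℚ < a → ∀ j → 0ℚ < a ₍ j ₎
0<rising 0<a zero    = positive⁻¹ 1ℚ
0<rising 0<a (suc j) = 0<* (0<rising 0<a j) (+-mono-<-≤ 0<a (0≤fromℕ j))

summand-denominator≢0 : ∀ n k → NonZero
  (fromℕ (k !) * (fromℕ (3 ℕ.* n) + + 11 / 8) ₍ k ₎ * (fromℕ (4 ℕ.* n) + + 3 / 2) ₍ k ₎)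
summand-denominator≢0 n k = >-nonZero
  (0<* (0<* (0</ (k !) 1 {{k !≢0}}) (0<rising (0<shift (3 ℕ.* n) 11 8) k))
       (0<rising (0<shift (4 ℕ.* n) 3 2) k))
  where
  0<shift : ∀ s m d .{{_ : ℕ.NonZero m}} .{{_ : ℕ.NonZero d}} → 0ℚ < fromℕ s + + m / d
  0<shift s m d = +-mono-≤-< (0≤fromℕ s) (0</ m d)

closedForm-denominator≢0 : ∀ n → NonZero
  ((+ 11 / 56) ₍ n ₎ * (+ 43 / 56) ₍ n ₎ * (+ 19 / 56) ₍ n ₎ *
   (+ 51 / 56) ₍ n ₎ * (+ 27 / 56) ₍ n ₎ * (+ 59 / 56) ₍ n ₎)
closedForm-denominator≢0 n = >-nonZero
  (0<* (0<* (0<* (0<* (0<* (0<factor 11) (0<factor 43)) (0<factor 19))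
    (0<factor 51)) (0<factor 27)) (0<factor 59))
  where
  0<factor : ∀ m .{{_ : ℕ.NonZero m}} → 0ℚ < (+ m / 56) ₍ n ₎
  0<factor m = 0<rising (0</ m 56) n

{-# OPTIONS --safe #-}
module Submission where

-- The left side is a very-well-poised ₄F₃(-1) with a = 1/2, b = -m, m = 4n, and
-- c = 1/8 - 3n, so with q = 1 + a - c it should equal (1 + a)_m / (q)_m.  That
-- evaluation holds for every m with c kept fixed, and a WZ certificate in m
-- proves it.  The closed form then follows by expanding (3/2)_{4n} and
-- (11/8 + 3n)_{4n} = (11/8)_{7n} / (11/8)_{3n} with the multiplication formula
-- (y)_{dn} = (d^d)^n Π_{i<d} ((y + i)/d)_n for d = 3, 4, 7.

open import Defs
open import Algebra.Bundles using (module CommutativeRing)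
import Algebra.Properties.CommutativeMonoid.Sum as CommutativeMonoidSum
import Algebra.Properties.CommutativeSemiring.Exp as CommutativeSemiringExp
import Algebra.Properties.Semiring.Sum as SemiringSum
open import Data.Fin.Base using (Fin; zero; suc; toℕ)
open import Data.Fin.Properties using (all?)
open import Data.Integer.Base as ℤ using (+_)
import Data.Integer.Properties as ℤ
open import Data.Nat.Base as ℕ using (ℕ; zero; suc; _!; z<s; s<s; s<s⁻¹)
open import Data.Nat.Combinatorics using (_C_; k>n⇒nCk≡0; nCk+nC[k+1]≡[n+1]C[k+1]; nC1≡n)
open import Data.Nat.Coprimality using (1-coprimeTo) renaming (sym to coprime-sym)
import Data.Nat.Properties as ℕ
import Data.Nat.Tactic.RingSolver as ℕ-RingSolver
open import Data.Rational.Base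
  using (ℚ; mkℚ; 0ℚ; 1ℚ; ½; _/_; _+_; _*_; -_; _÷_; 1/_; _<_; NonZero; >-nonZero)
open import Data.Rational.Properties
open import Data.Unit.Base using (tt)
open import Function.Base using (_∘_; _$_)
open import Level using (0ℓ)
open import Relation.Binary.PropositionalEquality
  using (_≡_; refl; sym; trans; cong; cong₂; module ≡-Reasoning)
open import Relation.Nullary.Decidable using (dec⇒maybe; toWitness)
open import Tactic.RingSolver using (solve-∀)
open import Tactic.RingSolver.Core.AlmostCommutativeRing
  using (AlmostCommutativeRing; fromCommutativeRing)

open CommutativeMonoidSum +-0-commutativeMonoid using (sum-cong-≗; sum-replicate-zero)
open CommutativeMonoidSum *-1-commutativeMonoid using ()
  renaming ( sum to product; sum-cong-≗ to product-cong; ∑-distrib-+ to product-distrib-*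
           ; sum-replicate-zero to product-replicate-1)
open CommutativeSemiringExp (CommutativeRing.commutativeSemiring +-*-commutativeRing)
  using (^-distrib-*)
open SemiringSum (CommutativeRing.semiring +-*-commutativeRing) using (*-distribˡ-sum)

open ≡-Reasoning

-- Arithmetic of rational numbers

ℚ-ring : AlmostCommutativeRing 0ℓ 0ℓ
ℚ-ring = fromCommutativeRing +-*-commutativeRing (λ x → dec⇒maybe (0ℚ ≟ x))

-- The fraction `+ m / 1` is normalised through a gcd that is stuck for a variable `m`. Since 1 is
-- coprime to everything, an explicit `mkℚ` can replace it, and then `_+_` and `_*_` compute.
fromℕ≡mkℚ : ∀ m → fromℕ m ≡ mkℚ (+ m) 0 (coprime-sym (1-coprimeTo m))
fromℕ≡mkℚ m = normalize-coprime (coprime-sym (1-coprimeTo m))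

fromℕ-+ : ∀ m n → fromℕ (m ℕ.+ n) ≡ fromℕ m + fromℕ n
fromℕ-+ m n = sym $ trans (cong₂ _+_ (fromℕ≡mkℚ m) (fromℕ≡mkℚ n))
  (cong (_/ 1) (trans (cong₂ ℤ._+_ (ℤ.*-identityʳ (+ m)) (ℤ.*-identityʳ (+ n)))
                      (sym (ℤ.pos-+ m n))))

fromℕ-* : ∀ m n → fromℕ (m ℕ.* n) ≡ fromℕ m * fromℕ n
fromℕ-* m n = sym $ trans (cong₂ _*_ (fromℕ≡mkℚ m) (fromℕ≡mkℚ n))
  (cong (_/ 1) (sym (ℤ.pos-* m n)))

*-cancelʳ : ∀ {x y} z .{{_ : NonZero z}} → x * z ≡ y * z → x ≡ y
*-cancelʳ {x} {y} z xz≡yz = begin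
  x               ≡⟨ cancel x ⟨
  x * z * 1/ z    ≡⟨ cong (_* 1/ z) xz≡yz ⟩
  y * z * 1/ z    ≡⟨ cancel y ⟩
  y               ∎
  where
  cancel : ∀ w → w * z * 1/ z ≡ w
  cancel w = trans (*-assoc w z (1/ z)) (trans (cong (w *_) (*-inverseʳ z)) (*-identityʳ w))

÷-unique : ∀ {x y z} .{{_ : NonZero y}} → x ≡ z * y → x ÷ y ≡ z
÷-unique {x} {y} {z} x≡zy = *-cancelʳ y $ begin
  x * 1/ y * y      ≡⟨ *-assoc x (1/ y) y ⟩
  x * (1/ y * y)    ≡⟨ cong (x *_) (*-inverseˡ y) ⟩
  x * 1ℚ            ≡⟨ *-identityʳ x ⟩
  x                 ≡⟨ x≡zy ⟩
  z * y             ∎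

*-÷-assoc : ∀ x y z .{{_ : NonZero z}} → x * (y ÷ z) ≡ (x * y) ÷ z
*-÷-assoc x y z = sym (*-assoc x y (1/ z))

0<^ : ∀ {x} → 0ℚ < x → ∀ n → 0ℚ < x ^ n
0<^ 0<x zero    = positive⁻¹ 1ℚ
0<^ 0<x (suc n) = 0<* 0<x (0<^ 0<x n)

-- Lets reciprocals be compared through the equations that characterise them, with no `NonZero`
-- instances in sight.
inverse-unique : ∀ {x y z} → x * y ≡ 1ℚ → x * z ≡ 1ℚ → y ≡ z
inverse-unique {x} {y} {z} xy≡1 xz≡1 = begin
  y            ≡⟨ *-identityˡ y ⟨
  1ℚ * y       ≡⟨ cong (_* y) xz≡1 ⟨
  x * z * y    ≡⟨ swap x y z ⟩
  x * y * z    ≡⟨ cong (_* z) xy≡1 ⟩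
  1ℚ * z       ≡⟨ *-identityˡ z ⟩
  z            ∎
  where
  swap : ∀ x y z → x * z * y ≡ x * y * z
  swap = solve-∀ ℚ-ring

-- Rising factorials

rising-+ : ∀ x m n → x ₍ m ℕ.+ n ₎ ≡ x ₍ m ₎ * (x + fromℕ m) ₍ n ₎
rising-+ x m zero    = trans (cong (x ₍_₎) (ℕ.+-identityʳ m)) (sym (*-identityʳ _))
rising-+ x m (suc n) = begin
  x ₍ m ℕ.+ suc n ₎
    ≡⟨ cong (x ₍_₎) (ℕ.+-suc m n) ⟩
  x ₍ m ℕ.+ n ₎ * (x + fromℕ (m ℕ.+ n))
    ≡⟨ cong₂ _*_ (rising-+ x m n) (cong (_+_ x) (fromℕ-+ m n)) ⟩
  x ₍ m ₎ * (x + fromℕ m) ₍ n ₎ * (x + (fromℕ m + fromℕ n))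
    ≡⟨ regroup (x ₍ m ₎) ((x + fromℕ m) ₍ n ₎) x (fromℕ m) (fromℕ n) ⟩
  x ₍ m ₎ * ((x + fromℕ m) ₍ n ₎ * (x + fromℕ m + fromℕ n))
    ∎
  where
  regroup : ∀ p q x a b → p * q * (x + (a + b)) ≡ p * (q * (x + a + b))
  regroup = solve-∀ ℚ-ring

-- The definition peels off the last factor; peeling off the first one matches `product` over `Fin`
-- and relates the parameters `x` and `x + 1ℚ`.
rising-suc : ∀ x n → x ₍ suc n ₎ ≡ x * (x + 1ℚ) ₍ n ₎
rising-suc x n = trans (rising-+ x 1 n)
  (cong (_* (x + 1ℚ) ₍ n ₎) (trans (*-identityˡ _) (+-identityʳ x)))

rising≡product : ∀ x d → x ₍ d ₎ ≡ product {d} (λ i → x + fromℕ (toℕ i))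
rising≡product x zero    = refl
rising≡product x (suc d) = begin
  x ₍ suc d ₎
    ≡⟨ rising-suc x d ⟩
  x * (x + 1ℚ) ₍ d ₎
    ≡⟨ cong₂ _*_ (sym (+-identityʳ x)) (rising≡product (x + 1ℚ) d) ⟩
  (x + 0ℚ) * product {d} (λ i → x + 1ℚ + fromℕ (toℕ i))
    ≡⟨ cong ((x + 0ℚ) *_) (product-cong {d} λ i →
         trans (+-assoc x 1ℚ (fromℕ (toℕ i))) (cong (_+_ x) (sym (fromℕ-+ 1 (toℕ i))))) ⟩
  (x + 0ℚ) * product {d} (λ i → x + fromℕ (suc (toℕ i)))
    ∎

product-*ˡ : ∀ {d} c (f : Fin d → ℚ) → product (λ i → c * f i) ≡ c ^ d * product f
product-*ˡ {zero}  c f = refl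
product-*ˡ {suc d} c f = trans (cong (c * f zero *_) (product-*ˡ c (f ∘ suc)))
  (regroup c (f zero) (c ^ d) (product (f ∘ suc)))
  where
  regroup : ∀ c x e y → c * x * (e * y) ≡ c * e * (x * y)
  regroup = solve-∀ ℚ-ring

-- The factors are sorted by residue class modulo `d`. Passing from `n` to `suc n` adds a block of
-- `d` factors y + dn + i = d (z_i + n), one for each class, and so a further constant d^d.
rising-multiplication : ∀ {d} y (z : Fin d → ℚ) →
  (∀ i → fromℕ d * z i ≡ y + fromℕ (toℕ i)) →
  ∀ n → y ₍ d ℕ.* n ₎ ≡ (fromℕ d ^ d) ^ n * product (λ i → z i ₍ n ₎)
rising-multiplication {d} y z dz≡y+i zero = begin
  y ₍ d ℕ.* 0 ₎                 ≡⟨ cong (y ₍_₎) (ℕ.*-zeroʳ d) ⟩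
  1ℚ                            ≡⟨ product-replicate-1 d ⟨
  product {d} (λ _ → 1ℚ)        ≡⟨ *-identityˡ _ ⟨
  1ℚ * product {d} (λ _ → 1ℚ)   ∎
rising-multiplication {d} y z dz≡y+i (suc n) = begin
  y ₍ d ℕ.* suc n ₎
    ≡⟨ cong (y ₍_₎) (trans (ℕ.*-suc d n) (ℕ.+-comm d (d ℕ.* n))) ⟩
  y ₍ d ℕ.* n ℕ.+ d ₎
    ≡⟨ rising-+ y (d ℕ.* n) d ⟩
  y ₍ d ℕ.* n ₎ * (y + fromℕ (d ℕ.* n)) ₍ d ₎
    ≡⟨ cong₂ _*_ (rising-multiplication y z dz≡y+i n) top-block ⟩
  D ^ n * P * (D * Q)
    ≡⟨ regroup (D ^ n) P D Q ⟩
  D * D ^ n * (P * Q)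
    ≡⟨ cong (D * D ^ n *_) (product-distrib-* (λ i → z i ₍ n ₎) (λ i → z i + fromℕ n)) ⟨
  D * D ^ n * product (λ i → z i ₍ suc n ₎)
    ∎
  where
  D P Q : ℚ
  D = fromℕ d ^ d
  P = product (λ i → z i ₍ n ₎)
  Q = product (λ i → z i + fromℕ n)

  regroup : ∀ e p c q → e * p * (c * q) ≡ c * e * (p * q)
  regroup = solve-∀ ℚ-ring

  swap : ∀ y i e → y + e + i ≡ y + i + e
  swap = solve-∀ ℚ-ring

  factor : ∀ i → y + fromℕ (d ℕ.* n) + fromℕ (toℕ i) ≡ fromℕ d * (z i + fromℕ n)
  factor i = begin
    y + fromℕ (d ℕ.* n) + fromℕ (toℕ i)    ≡⟨ swap y (fromℕ (toℕ i)) _ ⟩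
    y + fromℕ (toℕ i) + fromℕ (d ℕ.* n)    ≡⟨ cong₂ _+_ (sym (dz≡y+i i)) (fromℕ-* d n) ⟩
    fromℕ d * z i + fromℕ d * fromℕ n      ≡⟨ *-distribˡ-+ (fromℕ d) (z i) (fromℕ n) ⟨
    fromℕ d * (z i + fromℕ n)              ∎

  top-block : (y + fromℕ (d ℕ.* n)) ₍ d ₎ ≡ D * Q
  top-block = trans (rising≡product _ d)
    (trans (product-cong factor) (product-*ˡ (fromℕ d) (λ i → z i + fromℕ n)))

-- Carrying the positivity proof as an argument makes reciprocals ordinary atoms, so that summands
-- become products the ring solver can rearrange.
rising⁻¹ : ∀ {x} → 0ℚ < x → ℕ → ℚ
rising⁻¹ {x} 0<x k = (1/ x ₍ k ₎) {{>-nonZero (0<rising 0<x k)}}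

rising-inverseʳ : ∀ {x} (0<x : 0ℚ < x) k → x ₍ k ₎ * rising⁻¹ 0<x k ≡ 1ℚ
rising-inverseʳ {x} 0<x k = *-inverseʳ (x ₍ k ₎) {{>-nonZero (0<rising 0<x k)}}

-- Directed from `k` to `suc k`: the reciprocal at `suc k` is the common factor, and the one at `k`
-- is a polynomial multiple of it.
rising⁻¹-step : ∀ {x} (0<x : 0ℚ < x) k → rising⁻¹ 0<x k ≡ rising⁻¹ 0<x (suc k) * (x + fromℕ k)
rising⁻¹-step {x} 0<x k = inverse-unique {x ₍ k ₎} (rising-inverseʳ 0<x k)
  (trans (regroup (x ₍ k ₎) (rising⁻¹ 0<x (suc k)) (x + fromℕ k)) (rising-inverseʳ 0<x (suc k)))
  where
  regroup : ∀ r u s → r * (u * s) ≡ r * s * u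
  regroup = solve-∀ ℚ-ring

-- Follows from (x)_{k+1} = x (x+1)_k. The parameter `y` is tied to `x + 1ℚ` only by an equation
-- because `fromℕ (suc m)` does not unfold to `1ℚ + fromℕ m` for variable `m`.
rising⁻¹-shift : ∀ {x y} (0<x : 0ℚ < x) (0<y : 0ℚ < y) → y ≡ x + 1ℚ →
  ∀ k → rising⁻¹ 0<y k ≡ x * rising⁻¹ 0<x (suc k)
rising⁻¹-shift {x} {y} 0<x 0<y y≡x+1 k = inverse-unique {y ₍ k ₎} (rising-inverseʳ 0<y k) $ begin
  y ₍ k ₎ * (x * u)         ≡⟨ cong (λ w → w ₍ k ₎ * (x * u)) y≡x+1 ⟩
  (x + 1ℚ) ₍ k ₎ * (x * u)  ≡⟨ regroup ((x + 1ℚ) ₍ k ₎) x u ⟩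
  x * (x + 1ℚ) ₍ k ₎ * u    ≡⟨ cong (_* u) (rising-suc x k) ⟨
  x ₍ suc k ₎ * u           ≡⟨ rising-inverseʳ 0<x (suc k) ⟩
  1ℚ                        ∎
  where
  u : ℚ
  u = rising⁻¹ 0<x (suc k)
  regroup : ∀ r x u → r * (x * u) ≡ x * r * u
  regroup = solve-∀ ℚ-ring

-- Binomial coefficients

-- The binomial coefficient C(m, k-1), with the convention C(m, -1) = 0 that extends Pascal's rule
-- and absorption to `k = 0`.
_Cpred_ : ℕ → ℕ → ℕ
m Cpred zero  = 0
m Cpred suc k = m C k

pascal : ∀ m k → suc m C k ≡ m C k ℕ.+ m Cpred k
pascal m zero    = refl
pascal m (suc k) = trans (sym (nCk+nC[k+1]≡[n+1]C[k+1] m k)) (ℕ.+-comm (m C k) (m C suc k))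

-- Induction on `m`: Pascal's rule splits the left side, one copy of `b` is set aside, and the two
-- induction hypotheses recombine by Pascal's rule into the remaining `suc m` copies.
absorption : ∀ m k → suc k ℕ.* (suc m C suc k) ≡ suc m ℕ.* (m C k)
absorption m zero = trans (ℕ.*-identityˡ _) (trans (nC1≡n (suc m)) (sym (ℕ.*-identityʳ (suc m))))
absorption zero (suc k) = begin
  suc (suc k) ℕ.* (1 C suc (suc k))    ≡⟨ cong (suc (suc k) ℕ.*_) (k>n⇒nCk≡0 {1} {suc (suc k)} (s<s z<s)) ⟩
  suc (suc k) ℕ.* 0                    ≡⟨ ℕ.*-zeroʳ (suc (suc k)) ⟩
  0                                    ≡⟨ cong (1 ℕ.*_) (k>n⇒nCk≡0 {0} {suc k} z<s) ⟨
  1 ℕ.* (0 C suc k)                    ∎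
absorption (suc m) (suc k) = begin
  suc (suc k) ℕ.* (suc (suc m) C suc (suc k))
    ≡⟨ cong (suc (suc k) ℕ.*_) (nCk+nC[k+1]≡[n+1]C[k+1] (suc m) (suc k)) ⟨
  suc (suc k) ℕ.* (b ℕ.+ (suc m C suc (suc k)))
    ≡⟨ split k b _ ⟩
  b ℕ.+ (suc k ℕ.* b ℕ.+ suc (suc k) ℕ.* (suc m C suc (suc k)))
    ≡⟨ cong (b ℕ.+_) (cong₂ ℕ._+_ (absorption m k) (absorption m (suc k))) ⟩
  b ℕ.+ (suc m ℕ.* (m C k) ℕ.+ suc m ℕ.* (m C suc k))
    ≡⟨ cong (b ℕ.+_) (ℕ.*-distribˡ-+ (suc m) (m C k) (m C suc k)) ⟨
  b ℕ.+ suc m ℕ.* ((m C k) ℕ.+ (m C suc k))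
    ≡⟨ cong (λ w → b ℕ.+ suc m ℕ.* w) (nCk+nC[k+1]≡[n+1]C[k+1] m k) ⟩
  suc (suc m) ℕ.* b
    ∎
  where
  b : ℕ
  b = suc m C suc k

  split : ∀ k x y → suc (suc k) ℕ.* (x ℕ.+ y) ≡ x ℕ.+ (suc k ℕ.* x ℕ.+ suc (suc k) ℕ.* y)
  split = ℕ-RingSolver.solve-∀

-- Absorption with C(m+1, k) expanded by Pascal's rule, which makes it a linear relation between
-- C(m, k) and C(m, k-1).
absorption-ℚ : ∀ m k →
  fromℕ k * (fromℕ (m C k) + fromℕ (m Cpred k)) ≡ fromℕ (suc m) * fromℕ (m Cpred k)
absorption-ℚ m k = begin
  fromℕ k * (fromℕ (m C k) + fromℕ (m Cpred k))  ≡⟨ cong (fromℕ k *_) (fromℕ-+ (m C k) (m Cpred k)) ⟨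
  fromℕ k * fromℕ (m C k ℕ.+ m Cpred k)          ≡⟨ cong (λ w → fromℕ k * fromℕ w) (pascal m k) ⟨
  fromℕ k * fromℕ (suc m C k)                    ≡⟨ fromℕ-* k (suc m C k) ⟨
  fromℕ (k ℕ.* (suc m C k))                      ≡⟨ cong fromℕ (lower k) ⟩
  fromℕ (suc m ℕ.* (m Cpred k))                  ≡⟨ fromℕ-* (suc m) (m Cpred k) ⟩
  fromℕ (suc m) * fromℕ (m Cpred k)              ∎
  where
  lower : ∀ k → k ℕ.* (suc m C k) ≡ suc m ℕ.* (m Cpred k)
  lower zero    = sym (ℕ.*-zeroʳ (suc m))
  lower (suc k) = absorption m k

-- Both sides are the falling factorial m (m-1) ... (m-k+1). This trades the sign and the parameter
-- -m for a binomial coefficient, whose `k !` cancels the one in the summand's denominator.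
signed-rising : ∀ m k → (- 1ℚ) ^ k * (- fromℕ m) ₍ k ₎ ≡ fromℕ (m C k) * fromℕ (k !)
signed-rising m zero    = refl
signed-rising m (suc k) = begin
  - 1ℚ * (- 1ℚ) ^ k * ((- fromℕ m) ₍ k ₎ * (- fromℕ m + fromℕ k))
    ≡⟨ regroup₁ ((- 1ℚ) ^ k) ((- fromℕ m) ₍ k ₎) (fromℕ m) (fromℕ k) ⟩
  (- 1ℚ) ^ k * (- fromℕ m) ₍ k ₎ * (fromℕ m + - fromℕ k)
    ≡⟨ cong (_* (fromℕ m + - fromℕ k)) (signed-rising m k) ⟩
  fromℕ (m C k) * fromℕ (k !) * (fromℕ m + - fromℕ k)
    -- Writing m - k as (m + 1) - (k + 1) exposes the right side of absorption at `suc k`.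
    ≡⟨ regroup₂ (fromℕ (m C k)) (fromℕ (k !)) (fromℕ m) (fromℕ k) ⟩
  ((1ℚ + fromℕ m) * fromℕ (m C k) + - ((1ℚ + fromℕ k) * fromℕ (m C k))) * fromℕ (k !)
    ≡⟨ cong (λ w → (w + - ((1ℚ + fromℕ k) * fromℕ (m C k))) * fromℕ (k !)) absorbed ⟨
  ((1ℚ + fromℕ k) * (fromℕ (m C suc k) + fromℕ (m C k)) + - ((1ℚ + fromℕ k) * fromℕ (m C k)))
    * fromℕ (k !)
    ≡⟨ regroup₃ (1ℚ + fromℕ k) (fromℕ (m C suc k)) (fromℕ (m C k)) (fromℕ (k !)) ⟩
  fromℕ (m C suc k) * ((1ℚ + fromℕ k) * fromℕ (k !))
    ≡⟨ cong (λ w → fromℕ (m C suc k) * (w * fromℕ (k !))) (fromℕ-+ 1 k) ⟨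
  fromℕ (m C suc k) * (fromℕ (suc k) * fromℕ (k !))
    ≡⟨ cong (fromℕ (m C suc k) *_) (fromℕ-* (suc k) (k !)) ⟨
  fromℕ (m C suc k) * fromℕ (suc k !)
    ∎
  where
  regroup₁ : ∀ e r m k → - 1ℚ * e * (r * (- m + k)) ≡ e * r * (m + - k)
  regroup₁ = solve-∀ ℚ-ring

  regroup₂ : ∀ b f m k → b * f * (m + - k) ≡ ((1ℚ + m) * b + - ((1ℚ + k) * b)) * f
  regroup₂ = solve-∀ ℚ-ring

  regroup₃ : ∀ l x y f → (l * (x + y) + - (l * y)) * f ≡ x * (l * f)
  regroup₃ = solve-∀ ℚ-ring

  absorbed : (1ℚ + fromℕ k) * (fromℕ (m C suc k) + fromℕ (m C k)) ≡ (1ℚ + fromℕ m) * fromℕ (m C k)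
  absorbed = begin
    (1ℚ + fromℕ k) * (fromℕ (m C suc k) + fromℕ (m C k))  ≡⟨ cong (_* (fromℕ (m C suc k) + fromℕ (m C k))) (fromℕ-+ 1 k) ⟨
    fromℕ (suc k) * (fromℕ (m C suc k) + fromℕ (m C k))   ≡⟨ absorption-ℚ m (suc k) ⟩
    fromℕ (suc m) * fromℕ (m C k)                         ≡⟨ cong (_* fromℕ (m C k)) (fromℕ-+ 1 m) ⟩
    (1ℚ + fromℕ m) * fromℕ (m C k)                        ∎

-- Summation of very-well-poised series

-- Kept additive to avoid subtraction. A sum over `Fin` loses its first summand, so the induction
-- ranges over all sequences and recurses on the shifted ones.
∑-telescope : ∀ α β (f h g : ℕ → ℚ) →
  (∀ k → α * f k + g (suc k) ≡ β * h k + g k) →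
  ∀ N → α * ∑[ i < N ] f (toℕ i) + g N ≡ β * ∑[ i < N ] h (toℕ i) + g 0
∑-telescope α β f h g step zero =
  cong (_+ g 0) (trans (*-zeroʳ α) (sym (*-zeroʳ β)))
∑-telescope α β f h g step (suc N) = begin
  α * (f 0 + F) + g (suc N)      ≡⟨ regroup₁ α (f 0) F (g (suc N)) ⟩
  α * f 0 + (α * F + g (suc N))  ≡⟨ cong (_+_ (α * f 0)) tail ⟩
  α * f 0 + (β * H + g 1)        ≡⟨ regroup₂ (α * f 0) (β * H) (g 1) ⟩
  α * f 0 + g 1 + β * H          ≡⟨ cong (_+ β * H) (step 0) ⟩
  β * h 0 + g 0 + β * H          ≡⟨ regroup₃ β (h 0) (g 0) H ⟩
  β * (h 0 + H) + g 0            ∎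
  where
  F H : ℚ
  F = ∑[ i < N ] f (suc (toℕ i))
  H = ∑[ i < N ] h (suc (toℕ i))

  tail : α * F + g (suc N) ≡ β * H + g 1
  tail = ∑-telescope α β (f ∘ suc) (h ∘ suc) (g ∘ suc) (step ∘ suc) N

  regroup₁ : ∀ α x y z → α * (x + y) + z ≡ α * x + (α * y + z)
  regroup₁ = solve-∀ ℚ-ring

  regroup₂ : ∀ x y z → x + (y + z) ≡ x + z + y
  regroup₂ = solve-∀ ℚ-ring

  regroup₃ : ∀ β x y z → β * x + y + β * z ≡ β * (x + z) + y
  regroup₃ = solve-∀ ℚ-ring

module WellPoised {a q : ℚ} (0<a : 0ℚ < a) (0<q : 0ℚ < q) where

  -- The well-poised condition pairs numerator and denominator parameters to c + q = 1 + a. Taking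
  -- `q` as primitive puts the positivity assumption on the parameter that is inverted.
  c : ℚ
  c = 1ℚ + a + - q

  0<1+a+ : ∀ m → 0ℚ < 1ℚ + a + fromℕ m
  0<1+a+ m = +-mono-<-≤ (+-mono-< (positive⁻¹ 1ℚ) 0<a) (0≤fromℕ m)

  weight : ℕ → ℕ → ℚ
  weight m k = a ₍ k ₎ * c ₍ k ₎ * (rising⁻¹ 0<q k * rising⁻¹ (0<1+a+ m) k)

  -- The factor a + 2k is `a` times the very-well-poised quotient (1 + a/2)_k / (a/2)_k, whence the
  -- extra `a` in `∑-term`.
  term : ℕ → ℕ → ℚ
  term m k = fromℕ (m C k) * (a + (fromℕ k + fromℕ k)) * weight m k

  -- G in the WZ relation (q + m) F(m+1,k) - (1 + a + m) F(m,k) = G(m,k) - G(m,k+1),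
  -- where F = term; the factor m Cpred k makes it vanish at k = 0 and for k > m + 1.
  certificate : ℕ → ℕ → ℚ
  certificate m k = (1ℚ + a + fromℕ m) * (fromℕ (m Cpred k) * (q + fromℕ k + - 1ℚ) * weight m k)

  -- Every term is a polynomial multiple of the common factor `E`. Dividing it out leaves a relation
  -- between C(m, k) and C(m, k-1) that holds modulo absorption.
  wz : ∀ m k →
    (q + fromℕ m) * term (suc m) k + certificate m (suc k) ≡
    (1ℚ + a + fromℕ m) * term m k + certificate m k
  wz m k = begin
    (q + M) * (fromℕ (suc m C k) * w * weight (suc m) k) + certificate m (suc k)
      ≡⟨ cong₂ _+_ (cong₂ (λ b e → (q + M) * (b * w * (A * B * (u k * e)))) pascal-ℚ v-shift)
                   (cong (λ e → s * (x * e * (A * (a + K) * (B * (c + K)) * (u′ * v′)))) q+k+1-1) ⟩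
    (q + M) * ((x + y) * w * (A * B * (u k * (s * v′))))
      + s * (x * (q + K) * (A * (a + K) * (B * (c + K)) * (u′ * v′)))
      ≡⟨ cong (λ e → (q + M) * ((x + y) * w * (A * B * (e * (s * v′))))
                     + s * (x * (q + K) * (A * (a + K) * (B * (c + K)) * (u′ * v′)))) u-step ⟩
    (q + M) * ((x + y) * w * (A * B * (u′ * (q + K) * (s * v′))))
      + s * (x * (q + K) * (A * (a + K) * (B * (c + K)) * (u′ * v′)))
      ≡⟨ regroup₁ (q + M) (x + y) w A B u′ v′ (q + K) s x (a + K) (c + K) ⟩
    E * ((q + M) * ((x + y) * w) + x * ((a + K) * (c + K)))
      -- The two sides of the relation differ by q - 1 - a - k times the absorption relation;
      -- including that multiple gives a pure polynomial identity.
      ≡⟨ cong (E *_) (identity a q K M x y) ⟩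
    E * (x * w * (s + K) + y * ((q + K + - 1ℚ) * (s + K))
         + (q + - 1ℚ + - a + - K) * (K * (x + y) + - ((1ℚ + M) * y)))
      ≡⟨ cong (λ e → E * (x * w * (s + K) + y * ((q + K + - 1ℚ) * (s + K))
                          + (q + - 1ℚ + - a + - K) * e)) vanishes ⟩
    E * (x * w * (s + K) + y * ((q + K + - 1ℚ) * (s + K)) + (q + - 1ℚ + - a + - K) * 0ℚ)
      ≡⟨ regroup₂ s A B u′ v′ (q + K) x w (s + K) y (q + K + - 1ℚ) (q + - 1ℚ + - a + - K) ⟩
    s * (x * w * (A * B * (u′ * (q + K) * (v′ * (s + K)))))
      + s * (y * (q + K + - 1ℚ) * (A * B * (u′ * (q + K) * (v′ * (s + K)))))
      ≡⟨ cong₂ (λ e f → s * (x * w * (A * B * (e * f))) + s * (y * (q + K + - 1ℚ) * (A * B * (e * f))))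
               u-step v-step ⟨
    (1ℚ + a + M) * term m k + certificate m k
      ∎
    where
    K M A B x y w s u′ v′ E : ℚ
    u : ℕ → ℚ
    K = fromℕ k
    M = fromℕ m
    A = a ₍ k ₎
    B = c ₍ k ₎
    x = fromℕ (m C k)
    y = fromℕ (m Cpred k)
    w = a + (K + K)
    s = 1ℚ + a + M
    u = rising⁻¹ 0<q
    u′ = u (suc k)
    v′ = rising⁻¹ (0<1+a+ m) (suc k)
    E = s * (A * B * (u′ * (q + K) * v′))

    pascal-ℚ : fromℕ (suc m C k) ≡ x + y
    pascal-ℚ = trans (cong fromℕ (pascal m k)) (fromℕ-+ (m C k) (m Cpred k))

    u-step : u k ≡ u′ * (q + K)
    u-step = rising⁻¹-step 0<q k

    v-step : rising⁻¹ (0<1+a+ m) k ≡ v′ * (s + K)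
    v-step = rising⁻¹-step (0<1+a+ m) k

    v-shift : rising⁻¹ (0<1+a+ (suc m)) k ≡ s * v′
    v-shift = rising⁻¹-shift (0<1+a+ m) (0<1+a+ (suc m))
      (trans (cong (_+_ (1ℚ + a)) (fromℕ-+ 1 m)) (shift a M)) k
      where
      shift : ∀ a m → 1ℚ + a + (1ℚ + m) ≡ 1ℚ + a + m + 1ℚ
      shift = solve-∀ ℚ-ring

    q+k+1-1 : q + fromℕ (suc k) + - 1ℚ ≡ q + K
    q+k+1-1 = trans (cong (λ e → q + e + - 1ℚ) (fromℕ-+ 1 k)) (cancel q K)
      where
      cancel : ∀ q k → q + (1ℚ + k) + - 1ℚ ≡ q + k
      cancel = solve-∀ ℚ-ring

    vanishes : K * (x + y) + - ((1ℚ + M) * y) ≡ 0ℚ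
    vanishes = begin
      K * (x + y) + - ((1ℚ + M) * y)           ≡⟨ cong (_+ - ((1ℚ + M) * y)) (absorption-ℚ m k) ⟩
      fromℕ (suc m) * y + - ((1ℚ + M) * y)     ≡⟨ cong (λ e → e * y + - ((1ℚ + M) * y)) (fromℕ-+ 1 m) ⟩
      (1ℚ + M) * y + - ((1ℚ + M) * y)          ≡⟨ +-inverseʳ ((1ℚ + M) * y) ⟩
      0ℚ                                       ∎

    identity : ∀ a q k m x y →
      (q + m) * ((x + y) * (a + (k + k))) + x * ((a + k) * (1ℚ + a + - q + k)) ≡
      x * (a + (k + k)) * (1ℚ + a + m + k) + y * ((q + k + - 1ℚ) * (1ℚ + a + m + k))
        + (q + - 1ℚ + - a + - k) * (k * (x + y) + - ((1ℚ + m) * y))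
    identity = solve-∀ ℚ-ring

    regroup₁ : ∀ qm b w A B u v qk s x ak ck →
      qm * (b * w * (A * B * (u * qk * (s * v)))) + s * (x * qk * (A * ak * (B * ck) * (u * v))) ≡
      s * (A * B * (u * qk * v)) * (qm * (b * w) + x * (ak * ck))
    regroup₁ = solve-∀ ℚ-ring

    regroup₂ : ∀ s A B u v qk x w sk y qk1 l →
      s * (A * B * (u * qk * v)) * (x * w * sk + y * (qk1 * sk) + l * 0ℚ) ≡
      s * (x * w * (A * B * (u * qk * (v * sk)))) + s * (y * qk1 * (A * B * (u * qk * (v * sk))))
    regroup₂ = solve-∀ ℚ-ring

  -- Induction on `m` with `a`, `q` and the range of summation fixed: summing `wz` over `k` gives a
  -- first-order recurrence in `m`. At m = 0 only k = 0 contributes, with value `a`.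
  ∑-term : ∀ m N → m ℕ.< N →
    (∑[ i < N ] term m (toℕ i)) * q ₍ m ₎ ≡ a * (1ℚ + a) ₍ m ₎
  ∑-term zero (suc N) _ = begin
    (term 0 0 + ∑[ i < N ] term 0 (suc (toℕ i))) * 1ℚ
      ≡⟨ cong (λ e → (term 0 0 + e) * 1ℚ) (trans (sum-cong-≗ {N} (λ i → beyond (toℕ i))) (sum-replicate-zero N)) ⟩
    (1ℚ * (a + 0ℚ) * 1ℚ + 0ℚ) * 1ℚ
      ≡⟨ simplify a ⟩
    a * 1ℚ
      ∎
    where
    simplify : ∀ a → (1ℚ * (a + 0ℚ) * 1ℚ + 0ℚ) * 1ℚ ≡ a * 1ℚ
    simplify = solve-∀ ℚ-ring

    beyond : ∀ k → term 0 (suc k) ≡ 0ℚ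
    beyond k = begin
      term 0 (suc k)
        ≡⟨ cong (λ e → fromℕ e * (a + (K + K)) * weight 0 (suc k)) (k>n⇒nCk≡0 {0} {suc k} z<s) ⟩
      0ℚ * (a + (K + K)) * weight 0 (suc k)
        ≡⟨ trans (cong (_* weight 0 (suc k)) (*-zeroˡ (a + (K + K)))) (*-zeroˡ (weight 0 (suc k))) ⟩
      0ℚ
        ∎
      where
      K : ℚ
      K = fromℕ (suc k)
  ∑-term (suc m) (suc N) m<N = begin
    S′ * (q ₍ m ₎ * (q + M))
      ≡⟨ regroup₁ S′ (q ₍ m ₎) (q + M) ⟩
    ((q + M) * S′ + 0ℚ) * q ₍ m ₎
      -- The upper boundary term contains `m Cpred suc N`, that is `m C N`, which vanishes because m
      -- < N.
      ≡⟨ cong (λ e → ((q + M) * S′ + e) * q ₍ m ₎) (certificate-0 (suc N) (k>n⇒nCk≡0 (s<s⁻¹ m<N))) ⟨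
    ((q + M) * S′ + certificate m (suc N)) * q ₍ m ₎
      ≡⟨ cong (_* q ₍ m ₎) (∑-telescope (q + M) (1ℚ + a + M) (term (suc m)) (term m) (certificate m) (wz m) (suc N)) ⟩
    ((1ℚ + a + M) * S + certificate m 0) * q ₍ m ₎
      ≡⟨ cong (λ e → ((1ℚ + a + M) * S + e) * q ₍ m ₎) (certificate-0 0 refl) ⟩
    ((1ℚ + a + M) * S + 0ℚ) * q ₍ m ₎
      ≡⟨ regroup₂ (1ℚ + a + M) S (q ₍ m ₎) ⟩
    (1ℚ + a + M) * (S * q ₍ m ₎)
      ≡⟨ cong ((1ℚ + a + M) *_) (∑-term m (suc N) (ℕ.<-trans (ℕ.n<1+n m) m<N)) ⟩
    (1ℚ + a + M) * (a * (1ℚ + a) ₍ m ₎)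
      ≡⟨ regroup₃ (1ℚ + a + M) a ((1ℚ + a) ₍ m ₎) ⟩
    a * ((1ℚ + a) ₍ m ₎ * (1ℚ + a + M))
      ∎
    where
    M S S′ : ℚ
    M = fromℕ m
    S = ∑[ i < suc N ] term m (toℕ i)
    S′ = ∑[ i < suc N ] term (suc m) (toℕ i)

    certificate-0 : ∀ k → m Cpred k ≡ 0 → certificate m k ≡ 0ℚ
    certificate-0 k C≡0 = trans
      (cong (λ e → (1ℚ + a + M) * (fromℕ e * (q + fromℕ k + - 1ℚ) * weight m k)) C≡0)
      (annihilate (1ℚ + a + M) (q + fromℕ k + - 1ℚ) (weight m k))
      where
      annihilate : ∀ s l w → s * (0ℚ * l * w) ≡ 0ℚ
      annihilate = solve-∀ ℚ-ring

    regroup₁ : ∀ x y z → x * (y * z) ≡ (z * x + 0ℚ) * y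
    regroup₁ = solve-∀ ℚ-ring

    regroup₂ : ∀ x y z → (x * y + 0ℚ) * z ≡ x * (y * z)
    regroup₂ = solve-∀ ℚ-ring

    regroup₃ : ∀ x y z → x * (y * z) ≡ y * (z * x)
    regroup₃ = solve-∀ ℚ-ring

-- Specialisation to a = 1/2 and m = 4n, and reduction to the closed form

theorem10 : ∀ (n N : ℕ) → 4 ℕ.* n ℕ.< N →
    ∑[ i < N ]
    (let k = toℕ i in
    ((- 1ℚ) ^ k * fromℕ (4 ℕ.* k ℕ.+ 1) *
    (((- fromℕ (4 ℕ.* n)) ₍ k ₎ * (- fromℕ (3 ℕ.* n) + + 1 / 8) ₍ k ₎ * ½ ₍ k ₎)
    ÷ (fromℕ (k !) * (fromℕ (3 ℕ.* n) + + 11 / 8) ₍ k ₎ * (fromℕ (4 ℕ.* n) + + 3 / 2) ₍ k ₎))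
    {{summand-denominator≢0 n k}}))
    ≡
    (+ (2 ℕ.^ 8 ℕ.* 3 ℕ.^ 3) / 7 ℕ.^ 7) ^ n *
    (((+ 11 / 24) ₍ n ₎ * (+ 3 / 8) ₍ n ₎ * (+ 7 / 8) ₍ n ₎ *
    (+ 19 / 24) ₍ n ₎ * ((+ 9 / 8) ₍ n ₎) ^ 2)
    ÷ ((+ 11 / 56) ₍ n ₎ * (+ 43 / 56) ₍ n ₎ * (+ 19 / 56) ₍ n ₎ *
    (+ 51 / 56) ₍ n ₎ * (+ 27 / 56) ₍ n ₎ * (+ 59 / 56) ₍ n ₎))
    {{closedForm-denominator≢0 n}}
theorem10 n N 4n<N = begin
  ∑[ i < N ] _
    ≡⟨ sum-cong-≗ {N} (λ i → summand (toℕ i)) ⟩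
  -- The factor 2 is 1/a: 4k + 1 = 2 (1/2 + 2k).
  ∑[ i < N ] (fromℕ 2 * term m (toℕ i))
    ≡⟨ *-distribˡ-sum {N} (fromℕ 2) (λ i → term m (toℕ i)) ⟨
  S
    ≡⟨ ÷-unique {{closedForm-denominator≢0 n}} (sym cleared) ⟨
  (K ^ n * numerator ÷ denominator) {{closedForm-denominator≢0 n}}
    ≡⟨ *-÷-assoc (K ^ n) numerator denominator {{closedForm-denominator≢0 n}} ⟨
  K ^ n * (numerator ÷ denominator) {{closedForm-denominator≢0 n}}
    ∎
  where
  m : ℕ
  m = 4 ℕ.* n

  K q numerator denominator : ℚ
  K = + (2 ℕ.^ 8 ℕ.* 3 ℕ.^ 3) / 7 ℕ.^ 7
  q = fromℕ (3 ℕ.* n) + + 11 / 8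
  numerator =
    (+ 11 / 24) ₍ n ₎ * (+ 3 / 8) ₍ n ₎ * (+ 7 / 8) ₍ n ₎ *
    (+ 19 / 24) ₍ n ₎ * ((+ 9 / 8) ₍ n ₎) ^ 2
  denominator =
    (+ 11 / 56) ₍ n ₎ * (+ 43 / 56) ₍ n ₎ * (+ 19 / 56) ₍ n ₎ *
    (+ 51 / 56) ₍ n ₎ * (+ 27 / 56) ₍ n ₎ * (+ 59 / 56) ₍ n ₎

  0<q : 0ℚ < q
  0<q = +-mono-≤-< (0≤fromℕ (3 ℕ.* n)) (0</ 11 8)

  open WellPoised {½} {q} (0</ 1 2) 0<q

  S : ℚ
  S = fromℕ 2 * ∑[ i < N ] term m (toℕ i)

  c≡ : - fromℕ (3 ℕ.* n) + + 1 / 8 ≡ c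
  c≡ = shift (fromℕ (3 ℕ.* n))
    where
    shift : ∀ x → - x + + 1 / 8 ≡ 1ℚ + ½ + - (x + + 11 / 8)
    shift = solve-∀ ℚ-ring

  summand : ∀ k →
    (- 1ℚ) ^ k * fromℕ (4 ℕ.* k ℕ.+ 1) *
      (((- fromℕ m) ₍ k ₎ * (- fromℕ (3 ℕ.* n) + + 1 / 8) ₍ k ₎ * ½ ₍ k ₎)
        ÷ (fromℕ (k !) * q ₍ k ₎ * (fromℕ m + + 3 / 2) ₍ k ₎)) {{summand-denominator≢0 n k}}
    ≡ fromℕ 2 * term m k
  summand k = trans (*-÷-assoc (e * fromℕ (4 ℕ.* k ℕ.+ 1)) (r * (- fromℕ (3 ℕ.* n) + + 1 / 8) ₍ k ₎ * h)
    (f * q ₍ k ₎ * (fromℕ m + + 3 / 2) ₍ k ₎) {{summand-denominator≢0 n k}})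
    (÷-unique {{summand-denominator≢0 n k}} (begin
      e * fromℕ (4 ℕ.* k ℕ.+ 1) * (r * (- fromℕ (3 ℕ.* n) + + 1 / 8) ₍ k ₎ * h)
        ≡⟨ cong₂ (λ x y → e * x * (r * y ₍ k ₎ * h)) 4k+1≡ c≡ ⟩
      e * (fromℕ 2 * w) * (r * c ₍ k ₎ * h)
        -- The inserted `1ℚ * 1ℚ` is about to become the two denominator rising factorials times
        -- their reciprocals.
        ≡⟨ regroup₁ e (fromℕ 2) w r (c ₍ k ₎) h ⟩
      (e * r) * (fromℕ 2 * w * (h * c ₍ k ₎)) * (1ℚ * 1ℚ)
        ≡⟨ cong₂ (λ x y → x * (fromℕ 2 * w * (h * c ₍ k ₎)) * y) (signed-rising m k)
             (cong₂ _*_ (sym (rising-inverseʳ 0<q k)) (sym (rising-inverseʳ (0<1+a+ m) k))) ⟩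
      (b * f) * (fromℕ 2 * w * (h * c ₍ k ₎)) * ((q ₍ k ₎ * u) * (p ₍ k ₎ * v))
        ≡⟨ regroup₂ b f (fromℕ 2) w (h * c ₍ k ₎) (q ₍ k ₎) u (p ₍ k ₎) v ⟩
      fromℕ 2 * term m k * (f * q ₍ k ₎ * p ₍ k ₎)
        ≡⟨ cong (λ x → fromℕ 2 * term m k * (f * q ₍ k ₎ * x ₍ k ₎)) (+-comm (+ 3 / 2) (fromℕ m)) ⟩
      fromℕ 2 * term m k * (f * q ₍ k ₎ * (fromℕ m + + 3 / 2) ₍ k ₎)
        ∎))
    where
    e r h b f w u v p : ℚ
    e = (- 1ℚ) ^ k
    r = (- fromℕ m) ₍ k ₎
    h = ½ ₍ k ₎
    b = fromℕ (m C k)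
    f = fromℕ (k !)
    w = ½ + (fromℕ k + fromℕ k)
    u = rising⁻¹ 0<q k
    v = rising⁻¹ (0<1+a+ m) k
    p = 1ℚ + ½ + fromℕ m

    4k+1≡ : fromℕ (4 ℕ.* k ℕ.+ 1) ≡ fromℕ 2 * w
    4k+1≡ = trans (fromℕ-+ (4 ℕ.* k) 1)
      (trans (cong (_+ 1ℚ) (fromℕ-* 4 k)) (double (fromℕ k)))
      where
      double : ∀ k → + 4 / 1 * k + 1ℚ ≡ + 2 / 1 * (½ + (k + k))
      double = solve-∀ ℚ-ring

    regroup₁ : ∀ e t w r c h → e * (t * w) * (r * c * h) ≡ (e * r) * (t * w * (h * c)) * (1ℚ * 1ℚ)
    regroup₁ = solve-∀ ℚ-ring

    regroup₂ : ∀ b f t w g q u p v →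
      (b * f) * (t * w * g) * ((q * u) * (p * v)) ≡ t * (b * w * (g * (u * v))) * (f * q * p)
    regroup₂ = solve-∀ ℚ-ring

  S*rising : S * q ₍ m ₎ ≡ (+ 3 / 2) ₍ m ₎
  S*rising = begin
    fromℕ 2 * T * q ₍ m ₎              ≡⟨ *-assoc (fromℕ 2) T (q ₍ m ₎) ⟩
    fromℕ 2 * (T * q ₍ m ₎)            ≡⟨ cong (fromℕ 2 *_) (∑-term m N 4n<N) ⟩
    fromℕ 2 * (½ * (+ 3 / 2) ₍ m ₎)    ≡⟨ *-assoc (fromℕ 2) ½ ((+ 3 / 2) ₍ m ₎) ⟨
    1ℚ * (+ 3 / 2) ₍ m ₎               ≡⟨ *-identityˡ ((+ 3 / 2) ₍ m ₎) ⟩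
    (+ 3 / 2) ₍ m ₎                    ∎
    where
    T : ℚ
    T = ∑[ i < N ] term m (toℕ i)

  -- The numbers (11/8 + i)/3; likewise `z₄` and `z₇` hold (3/2 + i)/4 and (11/8 + i)/7. Being
  -- closed fractions for each `i`, they let the hypothesis of `rising-multiplication` be decided by
  -- evaluation, and 27/24 and 35/56 reduce to 9/8 and 5/8.
  z₃ : Fin 3 → ℚ
  z₃ i = + (11 ℕ.+ 8 ℕ.* toℕ i) / 24

  z₄ : Fin 4 → ℚ
  z₄ i = + (3 ℕ.+ 2 ℕ.* toℕ i) / 8

  z₇ : Fin 7 → ℚ
  z₇ i = + (11 ℕ.+ 8 ℕ.* toℕ i) / 56

  ρ : ℕ → (d : ℕ) .{{_ : ℕ.NonZero d}} → ℚ
  ρ x d = (+ x / d) ₍ n ₎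

  D₃ D₄ D₇ : ℚ
  D₃ = fromℕ 3 ^ 3
  D₄ = fromℕ 4 ^ 4
  D₇ = fromℕ 7 ^ 7

  split₃ : (+ 11 / 8) ₍ 3 ℕ.* n ₎ ≡ D₃ ^ n * (ρ 11 24 * (ρ 19 24 * (ρ 9 8 * 1ℚ)))
  split₃ = rising-multiplication (+ 11 / 8) z₃
    (toWitness {a? = all? λ i → fromℕ 3 * z₃ i ≟ + 11 / 8 + fromℕ (toℕ i)} tt) n

  split₄ : (+ 3 / 2) ₍ 4 ℕ.* n ₎ ≡ D₄ ^ n * (ρ 3 8 * (ρ 5 8 * (ρ 7 8 * (ρ 9 8 * 1ℚ))))
  split₄ = rising-multiplication (+ 3 / 2) z₄
    (toWitness {a? = all? λ i → fromℕ 4 * z₄ i ≟ + 3 / 2 + fromℕ (toℕ i)} tt) n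

  split₇ : (+ 11 / 8) ₍ 7 ℕ.* n ₎ ≡
    D₇ ^ n * (ρ 11 56 * (ρ 19 56 * (ρ 27 56 * (ρ 5 8 * (ρ 43 56 * (ρ 51 56 * (ρ 59 56 * 1ℚ)))))))
  split₇ = rising-multiplication (+ 11 / 8) z₇
    (toWitness {a? = all? λ i → fromℕ 7 * z₇ i ≟ + 11 / 8 + fromℕ (toℕ i)} tt) n

  concatenation : (+ 11 / 8) ₍ 7 ℕ.* n ₎ ≡ (+ 11 / 8) ₍ 3 ℕ.* n ₎ * q ₍ m ₎
  concatenation = begin
    (+ 11 / 8) ₍ 7 ℕ.* n ₎
      ≡⟨ cong ((+ 11 / 8) ₍_₎) (ℕ.*-distribʳ-+ n 3 4) ⟩
    (+ 11 / 8) ₍ 3 ℕ.* n ℕ.+ m ₎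
      ≡⟨ rising-+ (+ 11 / 8) (3 ℕ.* n) m ⟩
    (+ 11 / 8) ₍ 3 ℕ.* n ₎ * (+ 11 / 8 + fromℕ (3 ℕ.* n)) ₍ m ₎
      ≡⟨ cong (λ x → (+ 11 / 8) ₍ 3 ℕ.* n ₎ * x ₍ m ₎) (+-comm (+ 11 / 8) (fromℕ (3 ℕ.* n))) ⟩
    (+ 11 / 8) ₍ 3 ℕ.* n ₎ * q ₍ m ₎
      ∎

  -- Both `D₃ * D₄` and `K * D₇` evaluate to 2^8 3^3, so the two distributions of the power meet by
  -- computation.
  constants : D₃ ^ n * D₄ ^ n ≡ K ^ n * D₇ ^ n
  constants = trans (sym (^-distrib-* D₃ D₄ n)) (^-distrib-* K D₇ n)

  -- The factor (5/8)_n, common to (3/2)_{4n} and (11/8)_{7n}, is cancelled here.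
  cleared : S * denominator ≡ K ^ n * numerator
  cleared = *-cancelʳ (D₇ ^ n * ρ 5 8)
    {{>-nonZero (0<* (0<^ (positive⁻¹ D₇) n) (0<rising (0</ 5 8) n))}} $ begin
    S * denominator * (D₇ ^ n * ρ 5 8)
      ≡⟨ collect₇ S (D₇ ^ n) (ρ 11 56) (ρ 19 56) (ρ 27 56) (ρ 5 8) (ρ 43 56) (ρ 51 56) (ρ 59 56) ⟩
    S * (D₇ ^ n * (ρ 11 56 * (ρ 19 56 * (ρ 27 56 * (ρ 5 8 * (ρ 43 56 * (ρ 51 56 * (ρ 59 56 * 1ℚ))))))))
      ≡⟨ cong (S *_) split₇ ⟨
    S * (+ 11 / 8) ₍ 7 ℕ.* n ₎
      ≡⟨ cong (S *_) concatenation ⟩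
    S * ((+ 11 / 8) ₍ 3 ℕ.* n ₎ * q ₍ m ₎)
      ≡⟨ swap S ((+ 11 / 8) ₍ 3 ℕ.* n ₎) (q ₍ m ₎) ⟩
    (+ 11 / 8) ₍ 3 ℕ.* n ₎ * (S * q ₍ m ₎)
      ≡⟨ cong ((+ 11 / 8) ₍ 3 ℕ.* n ₎ *_) S*rising ⟩
    (+ 11 / 8) ₍ 3 ℕ.* n ₎ * (+ 3 / 2) ₍ m ₎
      ≡⟨ cong₂ _*_ split₃ split₄ ⟩
    D₃ ^ n * (ρ 11 24 * (ρ 19 24 * (ρ 9 8 * 1ℚ))) *
      (D₄ ^ n * (ρ 3 8 * (ρ 5 8 * (ρ 7 8 * (ρ 9 8 * 1ℚ)))))
      ≡⟨ collect (D₃ ^ n) (D₄ ^ n) (ρ 11 24) (ρ 19 24) (ρ 9 8) (ρ 3 8) (ρ 5 8) (ρ 7 8) ⟩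
    D₃ ^ n * D₄ ^ n * (numerator * ρ 5 8)
      ≡⟨ cong (_* (numerator * ρ 5 8)) constants ⟩
    K ^ n * D₇ ^ n * (numerator * ρ 5 8)
      ≡⟨ interchange (K ^ n) (D₇ ^ n) numerator (ρ 5 8) ⟩
    K ^ n * numerator * (D₇ ^ n * ρ 5 8)
      ∎
    where
    collect₇ : ∀ s d r₁ r₂ r₃ r₄ r₅ r₆ r₇ →
      s * (r₁ * r₅ * r₂ * r₆ * r₃ * r₇) * (d * r₄) ≡
      s * (d * (r₁ * (r₂ * (r₃ * (r₄ * (r₅ * (r₆ * (r₇ * 1ℚ))))))))
    collect₇ = solve-∀ ℚ-ring

    swap : ∀ x y z → x * (y * z) ≡ y * (x * z)
    swap = solve-∀ ℚ-ring

    collect : ∀ d e r₁ r₂ r₃ s₁ s₂ s₃ →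
      d * (r₁ * (r₂ * (r₃ * 1ℚ))) * (e * (s₁ * (s₂ * (s₃ * (r₃ * 1ℚ))))) ≡
      d * e * (r₁ * s₁ * s₃ * r₂ * (r₃ * (r₃ * 1ℚ)) * s₂)
    collect = solve-∀ ℚ-ring

    interchange : ∀ w x y z → w * x * (y * z) ≡ w * y * (x * z)
    interchange = solve-∀ ℚ-ring
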